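{- Let $1\le i<j\le N$. If $n_i$ is not forward-connected to $n_j$, then there exist a node $n_{i'}$ with $0\le i'<i$, an integer $p\ge 0$ and indices $i<k_1<k_2<\dots<k_p<j$ such that $$C^{\mathbf{A}}_{k_1}+C^{\mathbf{A}}_{k_2}+\cdots+C^{\mathbf{A}}_{k_p}+C^{\mathbf{A}}_j=X_j^N-X_{i'}^N .$$ (When $p=0$ the left-hand side is just $C^{\mathbf{A}}_j$.)
   Context: Let $G$ be a finite tree (connected acyclic simple graph) with nodes $n_0,n_1,\dots,n_N$, where $n_0$ is a terminal node (degree one) and the nodes are indexed so that along the path in $G$ from $n_0$ to any node $n_i$ the successively encountered node indices strictly increase. Node $n_i$ is forward-adjacent to $n_k$ if $n_i$ and $n_k$ are adjacent and $i<k$. Node $n_i$ is forward-connected to $n_j$ ($i<j$ necessarily) if there is a sequence of nodes $n_i=n_{l_0},n_{l_1},\dots,n_{l_m}=n_j$ with $m\ge 1$ in which each $n_{l_t}$ is forward-adjacent to $n_{l_{t+1}}$. The forward adjacency matrix $\mathbf{A}$ of $G$ is the $N\times N$ matrix, with rows and columns indexed by $1,\dots,N$, given by $\mathbf{A}(i,j)=1$ if $i=j$, $\mathbf{A}(i,j)=-1$ if $n_i$ is forward-adjacent to $n_j$, and $\mathbf{A}(i,j)=0$ otherwise. $C^{\mathbf{Q}}_j$ denotes the $j$-th column of a matrix $\mathbf{Q}$. For $1\le i\le N$, $X_i^N$ is the $N$-dimensional column vector with $1$ as its $i$-th entry and zeros elsewhere; $X_0^N$ is the $N$-dimensional zero vector.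 -}

module Defs where

open import Level using (0ℓ)
open import Data.Nat.Base as ℕ using (ℕ; zero; suc)
open import Data.Integer.Base as ℤ using (ℤ; 0ℤ; 1ℤ; -1ℤ)
open import Data.Fin.Base using (Fin; zero; suc; _<_)
open import Data.Fin.Properties using (_≟_; _<?_)
open import Data.List.Base using (List; []; _∷_; length; drop; filter; allFin)
open import Data.List.Relation.Unary.Linked using (Linked)
open import Data.List.Relation.Unary.Unique.Propositional using (Unique)
open import Data.Vec.Functional using (Vector; zipWith; replicate)
open import Data.Bool.Base using (if_then_else_)
open import Data.Product.Base using (_×_)
open import Relation.Nullary using (¬_; does)
open import Relation.Nullary.Decidable using (_×-dec_)
open import Relation.Binary using (Rel; Decidable; Symmetric)
open import Relation.Binary.PropositionalEquality using (_≡_)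
open import Relation.Binary.Construct.Closure.Transitive using (TransClosure)

record SimpleGraph (n : ℕ) : Set₁ where
  field
    _~_      : Rel (Fin n) 0ℓ
    _~?_     : Decidable _~_
    ~-sym    : Symmetric _~_
    ~-irrefl : ∀ v → ¬ (v ~ v)

module _ {n : ℕ} (G : SimpleGraph n) where
  open SimpleGraph G

  data Walk : Fin n → Fin n → Set where
    []  : ∀ {u} → Walk u u
    _∷_ : ∀ {u v w} → u ~ v → Walk v w → Walk u w

  -- Both endpoints are included, so a walk with m edges has m + 1 entries.
  vertices : ∀ {u v} → Walk u v → List (Fin n)
  vertices {u} []      = u ∷ []
  vertices {u} (_ ∷ w) = u ∷ vertices w

  IsPath : ∀ {u v} → Walk u v → Set
  IsPath w = Unique (vertices w)

  -- At least three edges (so at least four entries in `vertices`), with no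
  -- repetition other than the coincidence of the two endpoints.
  IsCycle : ∀ {u} → Walk u u → Set
  IsCycle w = 4 ℕ.≤ length (vertices w) × Unique (drop 1 (vertices w))

  Connected : Set
  Connected = ∀ u v → Walk u v

  Acyclic : Set
  Acyclic = ∀ {u} (w : Walk u u) → ¬ IsCycle w

  IsTree : Set
  IsTree = Connected × Acyclic

  degree : Fin n → ℕ
  degree v = length (filter (v ~?_) (allFin n))

  IsTerminal : Fin n → Set
  IsTerminal v = degree v ≡ 1

  ForwardAdjacent : Rel (Fin n) 0ℓ
  ForwardAdjacent i k = (i ~ k) × (i < k)

  forwardAdjacent? : Decidable ForwardAdjacent
  forwardAdjacent? i k = (i ~? k) ×-dec (i <? k)

  ForwardConnected : Rel (Fin n) 0ℓ
  ForwardConnected = TransClosure ForwardAdjacent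

IndicesIncrease : ∀ {N} → SimpleGraph (suc N) → Set
IndicesIncrease G = ∀ {v} (w : Walk G zero v) → IsPath G w → Linked _<_ (vertices G w)

Matrix : ℕ → Set
Matrix N = Fin N → Fin N → ℤ

-- Nodes are n₀, …, n_N, indexed by Fin (suc N).  Rows and columns 1, …, N are
-- indexed by Fin N, with k : Fin N standing for the node index suc k.
forwardAdjacencyMatrix : ∀ {N} → SimpleGraph (suc N) → Matrix N
forwardAdjacencyMatrix G i j =
  if does (i ≟ j) then 1ℤ
  else if does (forwardAdjacent? G (suc i) (suc j)) then -1ℤ
  else 0ℤ

column : ∀ {N} → Matrix N → Fin N → Vector ℤ N
column Q j i = Q i j

X : ∀ {N} → Fin (suc N) → Vector ℤ N
X zero    = replicate _ 0ℤ
X (suc i) = λ r → if does (r ≟ i) then 1ℤ else 0ℤ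

infixr 6 _⊕_
infix  6 _⊖_

_⊕_ _⊖_ : ∀ {N} → Vector ℤ N → Vector ℤ N → Vector ℤ N
_⊕_ = zipWith ℤ._+_
_⊖_ = zipWith ℤ._-_

{-# OPTIONS --safe #-}
-- Every node other than n₀ has exactly one backward neighbour, its parent.  If u and u' are
-- both forward-adjacent to v, extend the path from n₀ to u by v and then u': were this a
-- path, its indices would increase and v < u'.  So u' lies on the path to u, whence u' ≤ u,
-- and u ≤ u' by symmetry.
-- Thus column j equals X_j − X_p with p the parent of j.  Climbing from j through the
-- successive parents above i the columns telescope; the climb cannot hit i, since n_i is not
-- forward-connected to n_j, so it ends at some i' < i.
module Submission where

open import Data.Nat.Base using (ℕ; suc; s<s⁻¹)
import Data.Nat.Properties as ℕ
open import Data.Integer.Base using (ℤ; _+_; _-_)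
open import Data.Integer.Properties using (+-assoc)
open import Data.Integer.Tactic.RingSolver using (solve-∀)
open import Data.Fin.Base using (Fin; zero; suc; _<_; _≤_)
open import Data.Fin.Properties using (_≟_; <-cmp; <-irrefl; ≤-antisym; suc-injective; 0≢1+n)
open import Data.Fin.Induction using (<-wellFounded)
open import Data.List.Base using (List; []; _∷_; _++_; map; foldr)
open import Data.List.Relation.Unary.Linked using (Linked; [-]; _∷_)
open import Data.List.Relation.Unary.All as All using (All; []; _∷_)
open import Data.List.Relation.Unary.All.Properties using (¬Any⇒All¬)
open import Data.List.Relation.Unary.Any using (here; there)
open import Data.List.Relation.Unary.AllPairs using ([]; _∷_)
open import Data.List.Membership.Propositional using (_∈_)
open import Data.Product.Base using (Σ-syntax; ∃; _×_; _,_; proj₂)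
open import Function.Base using (_∘_)
open import Induction.WellFounded using (Acc; acc)
open import Relation.Nullary using (¬_; yes; no; contradiction)
open import Relation.Nullary.Decidable using (dec-true; dec-false)
open import Relation.Binary using (Rel; tri<; tri≈; tri>)
import Relation.Binary.Construct.Closure.Transitive as TransClosure
open import Relation.Binary.PropositionalEquality using (_≡_; _≢_; _≗_; refl; sym; trans; cong; cong₂)
open import Defs

private
  variable
    n N : ℕ

module _ (G : SimpleGraph n) where
  open SimpleGraph G
  open import Data.List.Membership.DecPropositional (_≟_ {n}) using (_∈?_)

  infixl 5 _∷ʳ_

  _∷ʳ_ : ∀ {u v w} → Walk G u v → v ~ w → Walk G u w
  []      ∷ʳ e = e ∷ []
  (d ∷ w) ∷ʳ e = d ∷ (w ∷ʳ e)

  All-∷ʳ : ∀ {ℓ} {P : Fin n → Set ℓ} {u v w} (p : Walk G u v) (e : v ~ w) →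
           All P (vertices G p) → P w → All P (vertices G (p ∷ʳ e))
  All-∷ʳ []      e (a ∷ []) b = a ∷ b ∷ []
  All-∷ʳ (d ∷ p) e (a ∷ as) b = a ∷ All-∷ʳ p e as b

  IsPath-∷ʳ : ∀ {u v w} (p : Walk G u v) (e : v ~ w) →
              IsPath G p → All (_≢ w) (vertices G p) → IsPath G (p ∷ʳ e)
  IsPath-∷ʳ []      e _        (a ∷ []) = (a ∷ []) ∷ [] ∷ []
  IsPath-∷ʳ (d ∷ p) e (b ∷ bs) (a ∷ as) = All-∷ʳ p e b a ∷ IsPath-∷ʳ p e bs as

  path-from : ∀ {u v w} (p : Walk G u v) → IsPath G p → w ∈ vertices G p →
              Σ[ q ∈ Walk G w v ] IsPath G q
  path-from []      uq       (here refl) = [] , uq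
  path-from (d ∷ p) uq       (here refl) = d ∷ p , uq
  path-from (d ∷ p) (_ ∷ uq) (there m)   = path-from p uq m

  -- Loop erasure from the far end: if the new start already lies on the path built so far,
  -- `path-from` keeps only the part from that occurrence on.
  walk⇒path : ∀ {u v} → Walk G u v → Σ[ q ∈ Walk G u v ] IsPath G q
  walk⇒path []          = [] , [] ∷ []
  walk⇒path {u} (d ∷ w) with walk⇒path w
  ... | q , uq with u ∈? vertices G q
  ...   | yes u∈q = path-from q uq u∈q
  ...   | no  u∉q = d ∷ q , ¬Any⇒All¬ _ u∉q ∷ uq

  -- Serves `parent-≤` twice: it bounds a `u'` lying on the path to `u`, and it keeps `v`, which
  -- exceeds `u`, off that path.
  linked⇒≤-end : ∀ {u v} (p : Walk G u v) → Linked _<_ (vertices G p) →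
                 All (_≤ v) (vertices G p)
  linked⇒≤-end []               _        = ℕ.≤-refl ∷ []
  linked⇒≤-end (d ∷ [])         (l ∷ _)  = ℕ.<⇒≤ l ∷ ℕ.≤-refl ∷ []
  linked⇒≤-end (d ∷ p@(_ ∷ _))  (l ∷ ls) with linked⇒≤-end p ls
  ... | a ∷ as = ℕ.≤-trans (ℕ.<⇒≤ l) a ∷ a ∷ as

  linked⇒last-< : ∀ {u v w} (p : Walk G u v) (e : v ~ w) →
                  Linked _<_ (vertices G (p ∷ʳ e)) → v < w
  linked⇒last-< []              e (l ∷ _)  = l
  linked⇒last-< (_ ∷ [])        e (_ ∷ ls) = linked⇒last-< [] e ls
  linked⇒last-< (_ ∷ p@(_ ∷ _)) e (_ ∷ ls) = linked⇒last-< p e ls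

  linked⇒lastForwardAdjacent : ∀ {u v w} (e : u ~ v) (p : Walk G v w) →
                               Linked _<_ (vertices G (e ∷ p)) →
                               ∃ λ x → ForwardAdjacent G x w
  linked⇒lastForwardAdjacent e []      (l ∷ _)  = _ , e , l
  linked⇒lastForwardAdjacent _ (e ∷ p) (_ ∷ ls) = linked⇒lastForwardAdjacent e p ls

module _ (G : SimpleGraph (suc N)) (conn : Connected G) (incr : IndicesIncrease G) where
  open SimpleGraph G
  open import Data.List.Membership.DecPropositional (_≟_ {suc N}) using (_∈?_)

  parent : ∀ j → ∃ λ p → ForwardAdjacent G p (suc j)
  parent j with walk⇒path G (conn zero (suc j))
  -- The path has an edge because its endpoints `zero` and `suc j` differ; its last edge comes from
  -- the parent.
  ... | e ∷ p , path = linked⇒lastForwardAdjacent G e p (incr (e ∷ p) path)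

  parent-≤ : ∀ {u u' v} → ForwardAdjacent G u v → ForwardAdjacent G u' v → u' ≤ u
  parent-≤ {u} {u'} {v} (u~v , u<v) (u'~v , u'<v) with walk⇒path G (conn zero u)
  ... | p , path with u' ∈? vertices G p
  ...   | yes u'∈p = All.lookup (linked⇒≤-end G p (incr p path)) u'∈p
  ...   | no  u'∉p = contradiction v<u' (ℕ.<-asym u'<v)
    where
    q : Walk G zero v
    q = _∷ʳ_ G p u~v

    q-path : IsPath G q
    q-path = IsPath-∷ʳ G p u~v path
      (All.map (λ x≤u x≡v → <-irrefl x≡v (ℕ.≤-<-trans x≤u u<v)) (linked⇒≤-end G p (incr p path)))

    u'∉q : All (_≢ u') (vertices G q)
    u'∉q = All-∷ʳ G p u~v (All.map (_∘ sym) (¬Any⇒All¬ _ u'∉p))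
      (λ v≡u' → <-irrefl (sym v≡u') u'<v)

    v<u' : v < u'
    v<u' = linked⇒last-< G q (~-sym u'~v) (incr _ (IsPath-∷ʳ G q (~-sym u'~v) q-path u'∉q))

  parent-unique : ∀ {u u' v} → ForwardAdjacent G u v → ForwardAdjacent G u' v → u ≡ u'
  parent-unique f f' = ≤-antisym (parent-≤ f' f) (parent-≤ f f')

  -- By `parent-unique` the entry -1 occurs only in the row of `p`. If `p` is `zero` there is no
  -- such row, in agreement with `X zero` being the zero vector.
  column≗ : ∀ j {p} → ForwardAdjacent G p (suc j) →
            column (forwardAdjacencyMatrix G) j ≗ X (suc j) ⊖ X p
  column≗ j {zero} f r with r ≟ j
  ... | yes _ = refl
  ... | no  _
    rewrite dec-false (forwardAdjacent? G (suc r) (suc j)) (0≢1+n ∘ parent-unique f) = refl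
  column≗ j {suc m} f r with r ≟ j | r ≟ m
  ... | yes refl | yes refl = contradiction (proj₂ f) (ℕ.<-irrefl refl)
  ... | yes _    | no  _    = refl
  ... | no  _    | yes refl rewrite dec-true (forwardAdjacent? G (suc r) (suc j)) f = refl
  ... | no  _    | no  r≢m
    rewrite dec-false (forwardAdjacent? G (suc r) (suc j))
              (λ f' → r≢m (suc-injective (parent-unique f' f))) = refl

Linked-∷ʳ : ∀ {a ℓ} {A : Set a} {R : Rel A ℓ} (xs : List A) {y z} →
            Linked R (xs ++ y ∷ []) → R y z → Linked R ((xs ++ y ∷ []) ++ z ∷ [])
Linked-∷ʳ []           [-]      r = r ∷ [-]
Linked-∷ʳ (_ ∷ [])     (l ∷ ls) r = l ∷ Linked-∷ʳ [] ls r
Linked-∷ʳ (_ ∷ x ∷ xs) (l ∷ ls) r = l ∷ Linked-∷ʳ (x ∷ xs) ls r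

-- The final column is the initial value of the fold. When the climb passes from `y` to its child
-- `z`, the old initial value `f y` becomes the last list entry and `f z` takes its place.
⊕-foldr-∷ʳ : ∀ {a} {A : Set a} (f : A → Fin N → ℤ) xs y z →
             foldr _⊕_ (f z) (map f (xs ++ y ∷ [])) ≗ foldr _⊕_ (f y) (map f xs) ⊕ f z
⊕-foldr-∷ʳ f []       y z r = refl
⊕-foldr-∷ʳ f (x ∷ xs) y z r =
  trans (cong (f x r +_) (⊕-foldr-∷ʳ f xs y z r))
        (sym (+-assoc (f x r) _ _))

telescope : ∀ a b c → (b - c) + (a - b) ≡ a - c
telescope = solve-∀

corollary4p1 : ∀ (N : ℕ) (G : SimpleGraph (suc N)) →
    IsTree G → IsTerminal G zero → IndicesIncrease G →
    ∀ (i j : Fin N) → i < j →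
    ¬ ForwardConnected G (suc i) (suc j) →
    Σ[ i' ∈ Fin (suc N) ] Σ[ ks ∈ List (Fin N) ]
    ( i' < suc i
    × Linked _<_ (i ∷ ks ++ j ∷ [])
    × foldr _⊕_ (column (forwardAdjacencyMatrix G) j) (map (column (forwardAdjacencyMatrix G)) ks)
    ≗ X (suc j) ⊖ X i' )
corollary4p1 N G (conn , _) _ incr i j i<j = climb j (<-wellFounded j) i<j
  where
  C : Fin N → Fin N → ℤ
  C = column (forwardAdjacencyMatrix G)

  climb : ∀ j → Acc _<_ j → i < j → ¬ ForwardConnected G (suc i) (suc j) →
    Σ[ i' ∈ Fin (suc N) ] Σ[ ks ∈ List (Fin N) ]
    ( i' < suc i
    × Linked _<_ (i ∷ ks ++ j ∷ [])
    × foldr _⊕_ (C j) (map C ks) ≗ X (suc j) ⊖ X i' )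
  climb j (acc below) i<j ¬fc with parent G conn incr j
  ... | p , f with <-cmp p (suc i)
  ...   | tri< p<i _ _ = p , [] , p<i , i<j ∷ [-] , column≗ G conn incr j f
  -- Here the single edge `f` already forward-connects `suc i` to `suc j`.
  ...   | tri≈ _ refl _ = contradiction TransClosure.[ f ] ¬fc
  -- A parent above `suc i` is not `zero`, so it has a column `m`. A forward chain from `suc i` to
  -- `suc m` would extend by `f` to `suc j`, so the hypothesis passes to `m`.
  climb j (acc below) i<j ¬fc | suc m , f | tri> _ _ i<m
    with climb m (below (s<s⁻¹ (proj₂ f))) (s<s⁻¹ i<m) (λ fc → ¬fc (fc TransClosure.∷ʳ f))
  ... | i' , ks , i'<i , linked , sum≗ =
    i' , ks ++ m ∷ [] , i'<i , Linked-∷ʳ (i ∷ ks) linked (s<s⁻¹ (proj₂ f)) ,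
    λ r → trans (⊕-foldr-∷ʳ C ks m j r)
         -- The climb from `m` contributes `X (suc m) ⊖ X i'` and column `j` contributes
         -- `X (suc j) ⊖ X (suc m)`.
         (trans (cong₂ _+_ (sum≗ r) (column≗ G conn incr j f r))
                (telescope (X (suc j) r) (X (suc m) r) (X i' r)))
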